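{- Let $R_n$ be the $n\times n$ Redheffer matrix, i.e. the matrix whose $(i,j)$ entry ($1\le i,j\le n$) is $1$ if $i$ divides $j$ or if $j=1$, and is $0$ otherwise. The permanent of $R_n$ is $$1+\sum_{k=1}^n f(k),$$ where $f(k)$ is the number of ordered factorizations of the integer $k$ (with $f(1)=0$). The permutations of $\{1,\dots,n\}$ that contribute to this permanent are those in which there is just one cycle of length $>1$, the letter $1$ lives in that cycle, and the elements of that cycle form a division chain.
   Context: The permanent of an $n\times n$ matrix $A=(A_{i,j})$ is $\sum_{\sigma}\prod_{i=1}^n A_{i,\sigma(i)}$, the sum being over all permutations $\sigma$ of $\{1,\dots,n\}$. A permutation $\sigma$ contributes to the permanent of $R_n$ if it does not hit any $0$ entry of the matrix, i.e. $(R_n)_{i,\sigma(i)}\ne 0$ for all $i$. An ordered factorization of an integer $m$ is a representation $m=a_1a_2\cdots a_k$ in which all $a_i$ are integers $\ge 2$ and the order of the factors is important. The empty factorization is not counted in $f$, so $f(1)=0$; it is accounted for by the separate term $1$. The elements of a cycle $1\mapsto j_2\mapsto j_3\mapsto\cdots\mapsto j_k\mapsto 1$ form a division chain if the sequence $j_2,j_3,\dots,j_k$ is a chain under divisibility, i.e. $j_2$ divides $j_3$, $j_3$ divides $j_4$, and so on up to $j_k$.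
   Formalization: The identity permutation, which has no cycle of length >1 but contributes to the permanent since all diagonal entries of R_n are 1, is added to the contributing permutations; the stated description omits it and is false without it. -}

module Defs where

open import Data.Bool.Base using (if_then_else_)
open import Data.Empty using (⊥)
open import Data.Fin.Base using (Fin; zero; suc; toℕ; punchIn)
open import Data.Fin.Properties using (punchIn-injective)
open import Data.Fin.Permutation
  using (Permutation′; _⟨$⟩ʳ_; _≈_; id; insert; remove; insert-remove)
open import Data.List.Base
  using (List; []; _∷_; _++_; _∷ʳ_; [_]; map; tabulate; length; filter; upTo; allFin;
         cartesianProductWith; concatMap)
open import Data.List.Membership.Propositional using (_∈_; lose)
open import Data.List.Membership.Propositional.Properties
  using (∈-allFin; ∈-upTo⁺; ∈-cartesianProductWith⁺; ∈-cartesianProductWith⁻;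
         ∈-concatMap⁺; ∈-filter⁺; ∈-filter⁻)
import Data.List.Membership.Setoid.Properties as Membershipₛ
open import Data.List.Properties using (∷-injective)
open import Data.List.Relation.Unary.All as All using (All; []; _∷_; all?)
open import Data.List.Relation.Unary.AllPairs as AllPairs using (AllPairs; []; _∷_)
import Data.List.Relation.Unary.AllPairs.Properties as AllPairsₚ
import Data.List.Relation.Unary.All.Properties as Allₚ
open import Data.List.Relation.Binary.Disjoint.Propositional using (Disjoint)
open import Data.List.Relation.Unary.Any using (Any; here)
open import Data.List.Relation.Unary.Linked using (Linked)
open import Data.List.Relation.Unary.Unique.Propositional using (Unique)
import Data.List.Relation.Unary.Unique.Propositional.Properties as Uniqueₚ
import Data.List.Relation.Unary.Unique.Setoid.Properties as Uniqueₛ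
open import Data.Nat.Base using (ℕ; zero; suc; _*_; _≤_; _<_; z≤n; s≤s; >-nonZero)
open import Data.Nat.Divisibility using (_∣_; _∣?_)
open import Data.Nat.ListAction using (sum; product)
open import Data.Nat.Properties
  using (_≟_; _≤?_; ≤-trans; ≤-refl; *-mono-≤; m≤m+n; +-mono-≤; m≤m*n; m≤n*m; m≤n⇒m≤1+n; module ≤-Reasoning)
open import Data.Product.Base using (∃; ∃₂; _×_; _,_; proj₂)
open import Level using (0ℓ)
open import Relation.Binary.Bundles using (Setoid)
open import Relation.Binary.PropositionalEquality
  using (_≡_; _≢_; refl; sym; trans; cong; setoid)
open import Relation.Nullary using (¬_; Dec; yes; no; does)
open import Relation.Nullary.Decidable using (_×-dec_; _⊎-dec_; ¬?)

Matrix : ℕ → Set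
Matrix n = Fin n → Fin n → ℕ

-- Rows, columns and permuted letters are 1, …, n, while Fin n counts from 0.
letter : ∀ {n} → Fin n → ℕ
letter i = suc (toℕ i)

redheffer : ∀ n → Matrix n
redheffer n i j =
  if does ((letter i ∣? letter j) ⊎-dec (letter j ≟ 1)) then 1 else 0

-- Every permutation of Fin n exactly once up to pointwise equality: see
-- permutations-complete and permutations-distinct.
permutations : ∀ n → List (Permutation′ n)
permutations zero    = [ id ]
permutations (suc n) =
  cartesianProductWith (insert zero) (allFin (suc n)) (permutations n)

permanent : ∀ {n} → Matrix n → ℕ
permanent {n} A =
  sum (map (λ σ → product (tabulate (λ i → A i (σ ⟨$⟩ʳ i)))) (permutations n))

Contributes : ∀ {n} → Matrix n → Permutation′ n → Set
Contributes A σ = ∀ i → A i (σ ⟨$⟩ʳ i) ≢ 0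

IsOrderedFactorization : ℕ → List ℕ → Set
IsOrderedFactorization m as = as ≢ [] × All (2 ≤_) as × product as ≡ m

[]? : (as : List ℕ) → Dec (as ≡ [])
[]? []      = yes refl
[]? (_ ∷ _) = no λ ()

isOrderedFactorization? : ∀ m as → Dec (IsOrderedFactorization m as)
isOrderedFactorization? m as =
  ¬? ([]? as) ×-dec all? (2 ≤?_) as ×-dec (product as ≟ m)

words : {A : Set} → List A → ℕ → List (List A)
words xs zero    = [ [] ]
words xs (suc k) = cartesianProductWith _∷_ xs (words xs k)

-- Neither the factors of an ordered factorization of m nor their number can
-- exceed m, so the search below misses none: see orderedFactorizations-complete.
orderedFactorizations : ℕ → List (List ℕ)
orderedFactorizations m =
  filter (isOrderedFactorization? m)
    (concatMap (words (upTo (suc m))) (upTo (suc m)))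

f : ℕ → ℕ
f m = length (orderedFactorizations m)

-- A cycle c₁ ↦ c₂ ↦ ⋯ ↦ cₖ ↦ c₁ of σ is written as the list of its k distinct
-- elements, starting at any of them.
IsCycle : ∀ {n} → Permutation′ n → List (Fin n) → Set
IsCycle σ []       = ⊥
IsCycle σ (x ∷ xs) =
  Unique (x ∷ xs) × Linked (λ i j → σ ⟨$⟩ʳ i ≡ j) ((x ∷ xs) ∷ʳ x)

-- Two lists denote the same cycle when one is a rotation of the other.
infix 4 _≈ᶜ_
_≈ᶜ_ : {A : Set} → List A → List A → Set
c ≈ᶜ d = ∃₂ λ xs ys → c ≡ xs ++ ys × d ≡ ys ++ xs

IsLongCycle : ∀ {n} → Permutation′ n → List (Fin n) → Set
IsLongCycle σ c = IsCycle σ c × 1 < length c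

-- For a cycle c = (1 ↦ j₂ ↦ ⋯ ↦ jₖ ↦ 1), the chain is j₂ ∣ j₃ ∣ ⋯ ∣ jₖ.
FormsDivisionChain : ∀ {n} → List (Fin n) → Set
FormsDivisionChain c =
  ∃₂ λ one js → letter one ≡ 1 × c ≈ᶜ (one ∷ js) × Linked _∣_ (map letter js)

-- The identity has no long cycle, so it does not satisfy this.
HasSingleDivisionCycle : ∀ {n} → Permutation′ n → Set
HasSingleDivisionCycle σ =
  ∃ λ c → IsLongCycle σ c
        × (∀ d → IsLongCycle σ d → d ≈ᶜ c)
        × 1 ∈ map letter c
        × FormsDivisionChain c

permutationSetoid : ℕ → Setoid 0ℓ 0ℓ
permutationSetoid n = record
  { Carrier       = Permutation′ n
  ; _≈_           = _≈_
  ; isEquivalence = record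
    { refl  = λ _ → refl
    ; sym   = λ p i → sym (p i)
    ; trans = λ p q i → trans (p i) (q i)
    }
  }

insert-cong : ∀ {n} {j k : Fin (suc n)} {σ τ : Permutation′ n} →
              j ≡ k → σ ≈ τ → insert zero j σ ≈ insert zero k τ
insert-cong         refl σ≈τ zero    = refl
insert-cong {j = j} refl σ≈τ (suc i) = cong (punchIn j) (σ≈τ i)

insert-injective : ∀ {n} {j k : Fin (suc n)} {σ τ : Permutation′ n} →
                   insert zero j σ ≈ insert zero k τ → j ≡ k × σ ≈ τ
insert-injective {j = j} {k} {σ} {τ} eq with eq zero
... | refl = refl , λ i → punchIn-injective j _ _ (eq (suc i))

permutations-complete : ∀ {n} (σ : Permutation′ n) → Any (σ ≈_) (permutations n)
permutations-complete {zero}  σ = here λ ()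
permutations-complete {suc n} σ =
  Membershipₛ.∈-resp-≈ (permutationSetoid (suc n))
    {x = insert zero (σ ⟨$⟩ʳ zero) (remove zero σ)} {σ} (insert-remove zero σ)
    (Membershipₛ.∈-cartesianProductWith⁺
      (setoid (Fin (suc n))) (permutationSetoid n) (permutationSetoid (suc n))
      (λ {j} {k} {σ} {τ} → insert-cong {j = j} {k} {σ} {τ})
      (∈-allFin (σ ⟨$⟩ʳ zero)) (permutations-complete (remove zero σ)))

permutations-distinct : ∀ n → AllPairs (λ σ τ → ¬ (σ ≈ τ)) (permutations n)
permutations-distinct zero    = [] ∷ []
permutations-distinct (suc n) =
  Uniqueₛ.cartesianProductWith⁺
    (setoid (Fin (suc n))) (permutationSetoid n) (permutationSetoid (suc n))
    (insert zero)
    (λ {j} {k} {σ} {τ} → insert-injective {j = j} {k} {σ} {τ})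
    (Uniqueₚ.allFin⁺ (suc n)) (permutations-distinct n)

words-complete : ∀ {A : Set} {xs : List A} {w} → All (_∈ xs) w → w ∈ words xs (length w)
words-complete []       = here refl
words-complete (p ∷ ps) = ∈-cartesianProductWith⁺ _∷_ p (words-complete ps)

words-length : ∀ {A : Set} (xs : List A) k {w} → w ∈ words xs k → length w ≡ k
words-length xs zero    (here refl) = refl
words-length xs (suc k) w∈
  with _ , _ , _ , v∈ , refl ← ∈-cartesianProductWith⁻ _∷_ xs (words xs k) w∈
  = cong suc (words-length xs k v∈)

words-unique : ∀ {A : Set} {xs : List A} → Unique xs → ∀ k → Unique (words xs k)
words-unique xs! zero    = [] ∷ []
words-unique xs! (suc k) =
  Uniqueₚ.cartesianProductWith⁺ _∷_ ∷-injective xs! (words-unique xs! k)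

product>0 : ∀ {as} → All (2 ≤_) as → 1 ≤ product as
product>0 []         = ≤-refl
product>0 (2≤a ∷ ps) = *-mono-≤ (≤-trans (s≤s z≤n) 2≤a) (product>0 ps)

factors≤product : ∀ {as} → All (2 ≤_) as → All (_≤ product as) as
factors≤product []                  = []
factors≤product {a ∷ as} (2≤a ∷ ps) =
  m≤m*n a (product as) {{>-nonZero (product>0 ps)}} ∷
  All.map (λ b≤ → ≤-trans b≤ (m≤n*m (product as) a {{>-nonZero (≤-trans (s≤s z≤n) 2≤a)}}))
          (factors≤product ps)

length<product : ∀ {as} → All (2 ≤_) as → length as < product as
length<product []                  = ≤-refl
length<product {a ∷ as} (2≤a ∷ ps) = begin
  suc (suc (length as))   ≤⟨ s≤s (length<product ps) ⟩
  suc (product as)        ≤⟨ +-mono-≤ (product>0 ps) (m≤m+n (product as) 0) ⟩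
  2 * product as          ≤⟨ *-mono-≤ 2≤a ≤-refl ⟩
  a * product as          ∎
  where open ≤-Reasoning

orderedFactorizations-complete :
  ∀ {m as} → IsOrderedFactorization m as → as ∈ orderedFactorizations m
orderedFactorizations-complete {m} {as} p@(_ , 2≤as , refl) =
  ∈-filter⁺ (isOrderedFactorization? m)
    (∈-concatMap⁺ (words (upTo (suc m)))
      (lose (∈-upTo⁺ (m≤n⇒m≤1+n (length<product 2≤as)))
            (words-complete (All.map (λ a≤m → ∈-upTo⁺ (s≤s a≤m)) (factors≤product 2≤as)))))
    p

orderedFactorizations-sound :
  ∀ {m as} → as ∈ orderedFactorizations m → IsOrderedFactorization m as
orderedFactorizations-sound {m} as∈ =
  proj₂ (∈-filter⁻ (isOrderedFactorization? m)
           {xs = concatMap (words (upTo (suc m))) (upTo (suc m))} as∈)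

words-disjoint : ∀ {A : Set} (xs : List A) {k l} → k ≢ l → Disjoint (words xs k) (words xs l)
words-disjoint xs k≢l (w∈k , w∈l) =
  k≢l (trans (sym (words-length xs _ w∈k)) (words-length xs _ w∈l))

orderedFactorizations-unique : ∀ m → Unique (orderedFactorizations m)
orderedFactorizations-unique m =
  Uniqueₚ.filter⁺ (isOrderedFactorization? m)
    (Uniqueₚ.concat⁺
      (Allₚ.map⁺ (All.universal (words-unique upTo!) (upTo (suc m))))
      (AllPairsₚ.map⁺ (AllPairs.map (words-disjoint (upTo (suc m))) upTo!)))
  where upTo! = Uniqueₚ.upTo⁺ (suc m)

{-# OPTIONS --safe #-}

-- Expand the permanent along the rows 1, 2, …. Below the row j that currently meets
-- column 1 the matrix is upper triangular, so row j either takes column 1, which forces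
-- all later rows onto the diagonal, or takes a proper multiple d of j, which forces the
-- rows strictly between j and d onto the diagonal and hands column 1 to row d. Hence
-- the permanent counts the divisor chains 1 ∣ d₁ ∣ d₂ ∣ ⋯ in {1, …, n}, and the
-- successive quotients of a nonempty chain ending in m are an ordered factorization of m.
--
-- For the description of the permutations: along a cycle of a contributing permutation
-- each letter divides the next unless the next is 1. A cycle avoiding 1 is therefore
-- constant, and the cycle of 1 is a division chain.
module Submission where

open import Defs
open import Data.Bool.Base using (if_then_else_)
open import Data.Empty using (⊥-elim)
open import Data.Fin.Base using (Fin; zero; suc; toℕ; punchIn)
open import Data.Fin.Permutation
  using (Permutation′; _≈_; id; _⟨$⟩ʳ_; _⟨$⟩ˡ_; insert; inverseʳ)
open import Data.Fin.Properties as Finₚ using (toℕ-injective; injective⇒≤)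
open import Data.List.Base
  using (List; []; _∷_; _++_; _∷ʳ_; [_]; map; tabulate; length; lookup; drop; iterate; allFin;
         applyUpTo; cartesianProductWith; concatMap)
open import Data.List.Membership.DecPropositional using (_∈?_)
open import Data.List.Membership.Propositional using (_∈_; _∉_; lose; find)
open import Data.List.Membership.Propositional.Properties
  using (∈-++⁺ˡ; ∈-++⁺ʳ; ∈-++⁻; ∈-∃++; ∈-map⁺; ∈-map⁻; ∈-lookup; ∈-concatMap⁺; ∈-concatMap⁻;
         ∈-applyUpTo⁺; ∈-applyUpTo⁻)
open import Data.List.Membership.Propositional.Properties.WithK using (unique∧set⇒bag)
open import Data.List.Properties
  using (++-assoc; ++-identityʳ; length-++; length-map; map-++; map-∘; map-tabulate;
         tabulate-cong; ∷-injectiveʳ)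
open import Data.List.Relation.Binary.BagAndSetEquality using (∼bag⇒↭)
open import Data.List.Relation.Binary.Permutation.Propositional using (↭⇒↭ₛ)
import Data.List.Relation.Binary.Permutation.Propositional.Properties as ↭
import Data.List.Relation.Binary.Permutation.Setoid.Properties as ↭ₛ
open import Data.List.Relation.Unary.All as All using (All; []; _∷_)
import Data.List.Relation.Unary.All.Properties as Allₚ
open import Data.List.Relation.Unary.AllPairs using (AllPairs; []; _∷_)
import Data.List.Relation.Unary.AllPairs.Properties as AllPairsₚ
open import Data.List.Relation.Unary.Any using (here; there)
open import Data.List.Relation.Unary.Linked using (Linked; []; [-]; _∷_)
import Data.List.Relation.Unary.Linked.Properties as Linkedₚ
open import Data.List.Relation.Unary.Unique.Propositional using (Unique)
import Data.List.Relation.Unary.Unique.Propositional.Properties as Uniqueₚ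
open import Data.Nat.Base
  using (ℕ; zero; suc; _+_; _*_; _≤_; _<_; z≤n; s≤s; z<s; >-nonZero)
open import Data.Nat.Divisibility
  using (_∣_; _∣?_; divides; ∣-refl; ∣-reflexive; ∣-trans; ∣-antisym; >⇒∤; 1∣_)
open import Data.Nat.ListAction using (sum; product)
open import Data.Nat.ListAction.Properties using (sum-++)
open import Data.Nat.Properties
open import Data.Product.Base using (∃; ∃₂; _×_; _,_; proj₁; proj₂; map₁)
open import Data.Sum.Base using (_⊎_; inj₁; inj₂)
open import Function.Base using (_∘_)
open import Function.Bundles using (_⇔_; mk⇔; Equivalence)
open import Relation.Binary.PropositionalEquality
  using (_≡_; _≢_; refl; sym; trans; cong; cong₂; subst; subst₂; setoid; module ≡-Reasoning)
open import Relation.Nullary using (¬_; Dec; yes; no; does)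
open import Relation.Nullary.Decidable using (_⊎-dec_; dec-true; dec-false; decidable-stable)
open ≡-Reasoning

-- The permanent as a count of divisor chains

sum-*ˡ : ∀ {A : Set} a (g : A → ℕ) xs → sum (map (λ x → a * g x) xs) ≡ a * sum (map g xs)
sum-*ˡ a g []       = sym (*-zeroʳ a)
sum-*ˡ a g (x ∷ xs) = trans (cong (a * g x +_) (sum-*ˡ a g xs)) (sym (*-distribˡ-+ a (g x) _))

sum-cartesianProductWith :
  ∀ {A B C : Set} (h : A → B → C) (g : C → ℕ) xs ys →
  sum (map g (cartesianProductWith h xs ys)) ≡ sum (map (λ x → sum (map (g ∘ h x) ys)) xs)
sum-cartesianProductWith h g []       ys = refl
sum-cartesianProductWith h g (x ∷ xs) ys = begin
  sum (map g (map (h x) ys ++ rest))            ≡⟨ cong sum (map-++ g (map (h x) ys) rest) ⟩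
  sum (map g (map (h x) ys) ++ map g rest)      ≡⟨ sum-++ (map g (map (h x) ys)) (map g rest) ⟩
  sum (map g (map (h x) ys)) + sum (map g rest) ≡⟨ cong₂ _+_ (cong sum (sym (map-∘ ys))) (sum-cartesianProductWith h g xs ys) ⟩
  sum (map (g ∘ h x) ys) + sum (map (λ x → sum (map (g ∘ h x) ys)) xs) ∎
  where rest = cartesianProductWith h xs ys

-- `insert zero j σ` sends `zero` to `j` and `suc i` to `punchIn j (σ ⟨$⟩ʳ i)`, so the recursion of
-- `permutations` is already Laplace expansion along the first row.
permanent-expand : ∀ {n} (A : Matrix (suc n)) →
  permanent A ≡ sum (tabulate λ j → A zero j * permanent (λ i k → A (suc i) (punchIn j k)))
permanent-expand {n} A = begin
  permanent A
    ≡⟨ sum-cartesianProductWith (insert zero) _ (allFin (suc n)) (permutations n) ⟩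
  sum (map row (allFin (suc n)))
    ≡⟨ cong sum (map-tabulate (λ j → j) row) ⟩
  sum (tabulate row)
    ≡⟨ cong sum (tabulate-cong λ j → sum-*ˡ (A zero j) (term j) (permutations n)) ⟩
  sum (tabulate λ j → A zero j * permanent (λ i k → A (suc i) (punchIn j k))) ∎
  where
  term : Fin (suc n) → Permutation′ n → ℕ
  term j σ = product (tabulate λ i → A (suc i) (punchIn j (σ ⟨$⟩ʳ i)))
  row : Fin (suc n) → ℕ
  row j = sum (map (λ σ → A zero j * term j σ) (permutations n))

-- Σ g c (cs without c), over the occurrences of c in cs
sumPicks : ∀ {C : Set} → (C → List C → ℕ) → List C → ℕ
sumPicks g []       = 0
sumPicks g (c ∷ cs) = g c cs + sumPicks (λ d ds → g d (c ∷ ds)) cs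

-- The value 0 at ([], _ ∷ _) makes listPermanent-zero hold without a condition on the lengths.
listPermanent : ∀ {R C : Set} → (R → C → ℕ) → List R → List C → ℕ
listPermanent w []       []      = 1
listPermanent w []       (_ ∷ _) = 0
listPermanent w (r ∷ rs) cs      = sumPicks (λ c cs′ → w r c * listPermanent w rs cs′) cs

sumPicks-tabulate : ∀ {C : Set} {n} (g : C → List C → ℕ) (c : Fin (suc n) → C) →
  sumPicks g (tabulate c) ≡ sum (tabulate λ j → g (c j) (tabulate (c ∘ punchIn j)))
sumPicks-tabulate {n = zero}  g c = refl
sumPicks-tabulate {n = suc n} g c =
  cong (g (c zero) (tabulate (c ∘ suc)) +_) (sumPicks-tabulate (λ d ds → g d (c zero ∷ ds)) (c ∘ suc))

-- With rows and columns as lists of labels, a minor is a list with one entry deleted, and `punchIn`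
-- disappears from the rest of the computation.
permanent-tabulate : ∀ {R C : Set} {n} (w : R → C → ℕ) (r : Fin n → R) (c : Fin n → C) →
  permanent (λ i j → w (r i) (c j)) ≡ listPermanent w (tabulate r) (tabulate c)
permanent-tabulate {n = zero}  w r c = refl
permanent-tabulate {n = suc n} w r c = begin
  permanent (λ i j → w (r i) (c j))
    ≡⟨ permanent-expand (λ i j → w (r i) (c j)) ⟩
  sum (tabulate λ j → w (r zero) (c j) * permanent (λ i k → w (r (suc i)) (c (punchIn j k))))
    ≡⟨ cong sum (tabulate-cong λ j → cong (w (r zero) (c j) *_) (permanent-tabulate w (r ∘ suc) (c ∘ punchIn j))) ⟩
  sum (tabulate λ j → w (r zero) (c j) * listPermanent w (tabulate (r ∘ suc)) (tabulate (c ∘ punchIn j)))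
    ≡⟨ sumPicks-tabulate (λ d ds → w (r zero) d * listPermanent w (tabulate (r ∘ suc)) ds) c ⟨
  listPermanent w (tabulate r) (tabulate c) ∎

module _ {C : Set} where

  sumPicks-cong : ∀ {g h : C → List C → ℕ} → (∀ c cs → g c cs ≡ h c cs) →
                  ∀ cs → sumPicks g cs ≡ sumPicks h cs
  sumPicks-cong g≗h []       = refl
  sumPicks-cong g≗h (c ∷ cs) = cong₂ _+_ (g≗h c cs) (sumPicks-cong (λ d ds → g≗h d (c ∷ ds)) cs)

  sumPicks-zero : ∀ {g : C → List C → ℕ} → (∀ c cs → g c cs ≡ 0) → ∀ cs → sumPicks g cs ≡ 0
  sumPicks-zero g≡0 []       = refl
  sumPicks-zero g≡0 (c ∷ cs) = cong₂ _+_ (g≡0 c cs) (sumPicks-zero (λ d ds → g≡0 d (c ∷ ds)) cs)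

  -- Every pick other than the displayed `b` leaves that `b` in the remaining list, where `g`
  -- vanishes.
  sumPicks-only : ∀ {g : C → List C → ℕ} {b} → (∀ c {cs} → b ∈ cs → g c cs ≡ 0) →
                  ∀ bs {cs} → sumPicks g (bs ++ b ∷ cs) ≡ g b (bs ++ cs)
  sumPicks-only {g} {b} g≡0 [] {cs} = begin
    g b cs + sumPicks (λ d ds → g d (b ∷ ds)) cs ≡⟨ cong (g b cs +_) (sumPicks-zero (λ d ds → g≡0 d (here refl)) cs) ⟩
    g b cs + 0                                   ≡⟨ +-identityʳ _ ⟩
    g b cs                                       ∎
  sumPicks-only g≡0 (a ∷ bs) =
    cong₂ _+_ (g≡0 a (∈-++⁺ʳ bs (here refl))) (sumPicks-only (λ c → g≡0 c ∘ there) bs)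

  sumPicks-∈ : ∀ {g : C → List C → ℕ} {b cs} → (∀ ds → g b ds ≡ 0) →
               (∀ c {ds} → b ∈ ds → g c ds ≡ 0) → b ∈ cs → sumPicks g cs ≡ 0
  sumPicks-∈ gb≡0 g≡0 b∈cs with bs , _ , refl ← ∈-∃++ b∈cs = trans (sumPicks-only g≡0 bs) (gb≡0 _)

module _ {R C : Set} (w : R → C → ℕ) where

  -- Picking `c` gives a factor 0; any other pick leaves `c` to the remaining rows. Once the rows
  -- run out, `c` is a surplus column and the value is 0.
  listPermanent-zero : ∀ {c rs cs} → All (λ r → w r c ≡ 0) rs → c ∈ cs → listPermanent w rs cs ≡ 0
  listPermanent-zero []                    (here refl) = refl
  listPermanent-zero []                    (there _)   = refl
  listPermanent-zero {rs = r ∷ rs} (wrc≡0 ∷ rs0) c∈cs =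
    sumPicks-∈ (λ ds → cong (_* listPermanent w rs ds) wrc≡0)
               (λ d c∈ds → trans (cong (w r d *_) (listPermanent-zero rs0 c∈ds)) (*-zeroʳ (w r d)))
               c∈cs

module _ {A : Set} (w : A → A → ℕ) where

  -- Column p vanishes in all later rows, hence must be picked by row p.
  listPermanent-diagonal : ∀ ps {rs} qs {cs} →
    All (λ p → w p p ≡ 1) ps → AllPairs (λ p r → w r p ≡ 0) (ps ++ rs) →
    listPermanent w (ps ++ rs) (qs ++ ps ++ cs) ≡ listPermanent w rs (qs ++ cs)
  listPermanent-diagonal []       qs _             _              = refl
  listPermanent-diagonal (p ∷ ps) {rs} qs {cs} (wpp≡1 ∷ ps1) (p0 ∷ ps0) = begin
    listPermanent w (p ∷ ps ++ rs) (qs ++ p ∷ ps ++ cs)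
      ≡⟨ sumPicks-only (λ d p∈ds → trans (cong (w p d *_) (listPermanent-zero w p0 p∈ds)) (*-zeroʳ (w p d))) qs ⟩
    w p p * listPermanent w (ps ++ rs) (qs ++ ps ++ cs)
      ≡⟨ cong₂ _*_ wpp≡1 (listPermanent-diagonal ps qs ps1 ps0) ⟩
    1 * listPermanent w rs (qs ++ cs)
      ≡⟨ *-identityˡ _ ⟩
    listPermanent w rs (qs ++ cs) ∎

entry : ℕ → ℕ → ℕ
entry r c = if does ((r ∣? c) ⊎-dec (c ≟ 1)) then 1 else 0

entry-diag : ∀ r → entry r r ≡ 1
entry-diag r rewrite dec-true (r ∣? r) ∣-refl = refl

entry-first : ∀ r → entry r 1 ≡ 1
entry-first r with r ∣? 1
... | yes _ = refl
... | no  _ = refl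

entry-lower : ∀ {r c} → 2 ≤ c → c < r → entry r c ≡ 0
-- Matching on `2 ≤ c` exposes two successors, so `c ≟ 1` computes to false.
entry-lower {r} (s≤s (s≤s _)) c<r rewrite dec-false (r ∣? _) (>⇒∤ c<r) = refl

range : ℕ → ℕ → List ℕ
range = iterate suc

range-≥ : ∀ {m} b k → m ≤ b → All (m ≤_) (range b k)
range-≥ b zero    m≤b = []
range-≥ b (suc k) m≤b = m≤b ∷ range-≥ (suc b) k (m≤n⇒m≤1+n m≤b)

range-triangular : ∀ {b} k → 2 ≤ b → AllPairs (λ c r → entry r c ≡ 0) (range b k)
range-triangular zero    2≤b = []
range-triangular {b} (suc k) 2≤b =
  All.map (entry-lower 2≤b) (range-≥ (suc b) k ≤-refl) ∷ range-triangular k (m≤n⇒m≤1+n 2≤b)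

letters-range : ∀ n b → tabulate {n = n} (λ i → b + toℕ i) ≡ range b n
letters-range zero    b = refl
letters-range (suc n) b =
  cong₂ _∷_ (+-identityʳ b) (trans (tabulate-cong λ i → +-suc b (toℕ i)) (letters-range n (suc b)))

-- The nonempty words a₁ ∷ a₂ ∷ … for which the divisor chain j ∣ j a₁ ∣ j a₁ a₂ ∣ …
-- continues from j inside {b, …, b + k - 1}.
chainWords : ℕ → ℕ → ℕ → List (List ℕ)
chainWords zero    b j = []
chainWords (suc k) b j with j ∣? b
... | yes (divides q _) = map (q ∷_) ([] ∷ chainWords k (suc b) b) ++ chainWords k (suc b) j
... | no  _             = chainWords k (suc b) j

-- The recurrence of the row expansion at column `b`: a chain steps from `j` to `b` and then stops
-- or goes on, or its next element lies beyond `b`.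
length-chainWords : ∀ k {b} j → 2 ≤ b →
  length (chainWords (suc k) b j) ≡
  entry j b * suc (length (chainWords k (suc b) b)) + length (chainWords k (suc b) j)
length-chainWords k {b} j (s≤s (s≤s _)) with j ∣? b
... | no  _             = refl
... | yes (divides q _) = begin
  length (map (q ∷_) ws ++ vs)        ≡⟨ length-++ (map (q ∷_) ws) ⟩
  length (map (q ∷_) ws) + length vs  ≡⟨ cong (_+ length vs) (length-map (q ∷_) ws) ⟩
  length ws + length vs               ≡⟨ cong (_+ length vs) (*-identityˡ (length ws)) ⟨
  1 * length ws + length vs           ∎
  where
  ws = [] ∷ chainWords k (suc b) b
  vs = chainWords k (suc b) j

mutual

  -- The chain has reached `j`, and column `1` stands in the place of column `j`. If row `j` picks
  -- it, a triangular minor with unit diagonal remains: the chain that stops here.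
  listPermanent-chainWords : ∀ k j → 1 ≤ j →
    listPermanent entry (range j (suc k)) (1 ∷ range (suc j) k) ≡ suc (length (chainWords k (suc j) j))
  listPermanent-chainWords k j 1≤j = cong₂ _+_
    (begin
      entry j 1 * listPermanent entry (range (suc j) k) (range (suc j) k)
        ≡⟨ cong₂ (λ m js → m * listPermanent entry js js) (entry-first j) (sym (++-identityʳ (range (suc j) k))) ⟩
      1 * listPermanent entry (range (suc j) k ++ []) (range (suc j) k ++ [])
        ≡⟨ cong (1 *_) (listPermanent-diagonal entry (range (suc j) k) []
             (All.universal entry-diag _)
             (subst (AllPairs _) (sym (++-identityʳ _)) (range-triangular k (s≤s 1≤j)))) ⟩
      1 ∎)
    (sumPicks-chainWords k j [] (s≤s 1≤j) (range-triangular k (s≤s 1≤j)))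

  -- `ps` collects the rows strictly between `j` and `b`. If row `j` picks column `b`, these go onto
  -- the diagonal and row `b` inherits column `1`; otherwise `b` is appended to `ps`.
  sumPicks-chainWords : ∀ k {b} j ps → 2 ≤ b → AllPairs (λ c r → entry r c ≡ 0) (ps ++ range b k) →
    sumPicks (λ d ds → entry j d * listPermanent entry (ps ++ range b k) (1 ∷ ps ++ ds)) (range b k)
      ≡ length (chainWords k b j)
  sumPicks-chainWords zero        j ps 2≤b tri = refl
  sumPicks-chainWords (suc k) {b} j ps 2≤b tri = trans
    (cong₂ _+_
      (cong (entry j b *_)
        (trans (listPermanent-diagonal entry ps [ 1 ] (All.universal entry-diag ps) tri)
               (listPermanent-chainWords k b (≤-trans (s≤s z≤n) 2≤b))))
      (trans
        (sumPicks-cong (λ d ds → cong (entry j d *_)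
          (cong₂ (listPermanent entry) (sym (assoc _)) (cong (1 ∷_) (sym (assoc ds))))) (range (suc b) k))
        (sumPicks-chainWords k j (ps ∷ʳ b) (m≤n⇒m≤1+n 2≤b) (subst (AllPairs _) (sym (assoc _)) tri))))
    (sym (length-chainWords k j 2≤b))
    where
    assoc : ∀ zs → (ps ∷ʳ b) ++ zs ≡ ps ++ b ∷ zs
    assoc zs = ++-assoc ps [ b ] zs

permanent-redheffer : ∀ k → permanent (redheffer (suc k)) ≡ suc (length (chainWords k 2 1))
permanent-redheffer k = begin
  permanent (redheffer (suc k))
    ≡⟨ permanent-tabulate entry (letter {suc k}) letter ⟩
  listPermanent entry (tabulate (letter {suc k})) (tabulate (letter {suc k}))
    ≡⟨ cong₂ (listPermanent entry) (letters-range (suc k) 1) (letters-range (suc k) 1) ⟩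
  listPermanent entry (range 1 (suc k)) (range 1 (suc k))
    ≡⟨ listPermanent-chainWords k 1 ≤-refl ⟩
  suc (length (chainWords k 2 1)) ∎

-- Divisor chains and ordered factorizations

-- `a * j` is the first chain element after `j` and `product w * j` the last, so the two bounds
-- place the chain in the window. For `j < b` the first bound also gives `2 ≤ a`.
IsChainWord : ℕ → ℕ → ℕ → List ℕ → Set
IsChainWord k b j w =
  ∃₂ λ a as → w ≡ a ∷ as × b ≤ a * j × All (2 ≤_) as × product w * j < b + k

product-∷ : ∀ a as {b j} → b ≡ a * j → product (a ∷ as) * j ≡ product as * b
product-∷ a as {j = j} refl = trans (cong (_* j) (*-comm a (product as))) (*-assoc (product as) a j)

isChainWord-weaken : ∀ k {b j w} → IsChainWord k (suc b) j w → IsChainWord (suc k) b j w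
isChainWord-weaken k {b} (a , as , eq , b< , 2≤as , p<) =
  a , as , eq , <⇒≤ b< , 2≤as , <-≤-trans p< (≤-reflexive (sym (+-suc b k)))

chainWords-sound : ∀ k b j {w} → 1 ≤ b → w ∈ chainWords k b j → IsChainWord k b j w
chainWords-sound (suc k) b j 1≤b w∈ with j ∣? b
... | no _ = isChainWord-weaken k (chainWords-sound k (suc b) j (s≤s z≤n) w∈)
... | yes (divides q b≡q*j)
  with ∈-++⁻ (map (q ∷_) ([] ∷ chainWords k (suc b) b)) w∈
... | inj₂ w∈′ = isChainWord-weaken k (chainWords-sound k (suc b) j (s≤s z≤n) w∈′)
... | inj₁ w∈′ with ∈-map⁻ (q ∷_) w∈′
... | .[] , here refl , refl =
  q , [] , refl , ≤-reflexive b≡q*j , [] ,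
  subst (_< b + suc k) (sym (trans (product-∷ q [] b≡q*j) (*-identityˡ b))) (m<m+n b z<s)
... | v , there v∈ , refl
  with a , as , refl , b≤ , 2≤as , p< ← chainWords-sound k (suc b) b (s≤s z≤n) v∈ =
  -- The chain goes on past `b`, so `1 * b < a * b`, whence `2 ≤ a`.
  q , v , refl , ≤-reflexive b≡q*j , *-cancelʳ-< b 1 a (subst (_< a * b) (sym (*-identityˡ b)) b≤) ∷ 2≤as ,
  subst₂ _<_ (sym (product-∷ q v b≡q*j)) (sym (+-suc b k)) p<

-- Compare `b` with the first chain element `a * j`: if they agree, the word starts with the
-- quotient `q` found at `b`; otherwise the window moves up past `b`.
chainWords-complete : ∀ k b j {w} → 1 ≤ b → 1 ≤ j → IsChainWord k b j w → w ∈ chainWords k b j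
chainWords-complete zero b j 1≤b 1≤j (a , as , refl , b≤ , 2≤as , p<) =
  -- The window is empty, but `b ≤ a * j ≤ product (a ∷ as) * j < b`.
  ⊥-elim (<⇒≱ (<-≤-trans p< (≤-reflexive (+-identityʳ b)))
    (≤-trans b≤ (*-monoˡ-≤ j (m≤m*n a (product as) {{>-nonZero (product>0 2≤as)}}))))
chainWords-complete (suc k) b j 1≤b 1≤j (a , as , refl , b≤ , 2≤as , p<) with j ∣? b
... | no j∤b = chainWords-complete k (suc b) j (s≤s z≤n) 1≤j
  (a , as , refl , ≤∧≢⇒< b≤ (j∤b ∘ divides a) , 2≤as , <-≤-trans p< (≤-reflexive (+-suc b k)))
... | yes (divides q b≡q*j) with b ≟ a * j
... | no b≢ = ∈-++⁺ʳ (map (q ∷_) ([] ∷ chainWords k (suc b) b)) (chainWords-complete k (suc b) j (s≤s z≤n) 1≤j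
  (a , as , refl , ≤∧≢⇒< b≤ b≢ , 2≤as , <-≤-trans p< (≤-reflexive (+-suc b k))))
... | yes b≡a*j with refl ← *-cancelʳ-≡ q a j {{>-nonZero 1≤j}} (trans (sym b≡q*j) b≡a*j) =
  ∈-++⁺ˡ (∈-map⁺ (q ∷_) (tail∈ as 2≤as (subst₂ _<_ (product-∷ a as b≡a*j) (+-suc b k) p<)))
  where
  tail∈ : ∀ as → All (2 ≤_) as → product as * b < suc (b + k) → as ∈ [] ∷ chainWords k (suc b) b
  tail∈ []       _            _  = here refl
  tail∈ (c ∷ cs) (2≤c ∷ 2≤cs) p< = there (chainWords-complete k (suc b) b (s≤s z≤n) 1≤b
    (c , cs , refl , subst (_< c * b) (*-identityˡ b) (*-monoˡ-< b {{>-nonZero 1≤b}} 2≤c) , 2≤cs , p<))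

-- The two blocks differ in the first chain element, which is `b` or larger. Inside the first block
-- the word that stops at `b` is distinct from the others because `chainWords` contains only
-- nonempty words.
chainWords-unique : ∀ k b j → 1 ≤ b → Unique (chainWords k b j)
chainWords-unique zero    b j 1≤b = []
chainWords-unique (suc k) b j 1≤b with j ∣? b
... | no _ = chainWords-unique k (suc b) j (s≤s z≤n)
... | yes (divides q b≡q*j) =
  Uniqueₚ.++⁺ (Uniqueₚ.map⁺ ∷-injectiveʳ ([]∉ ∷ chainWords-unique k (suc b) b (s≤s z≤n)))
              (chainWords-unique k (suc b) j (s≤s z≤n)) disjoint
  where
  []∉ : All ([] ≢_) (chainWords k (suc b) b)
  []∉ = All.tabulate λ v∈ eq → case-[] (chainWords-sound k (suc b) b (s≤s z≤n) (subst (_∈ _) (sym eq) v∈))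
    where
    case-[] : ¬ IsChainWord k (suc b) b []
    case-[] (_ , _ , () , _)
  disjoint : ∀ {w} → ¬ (w ∈ map (q ∷_) ([] ∷ chainWords k (suc b) b) × w ∈ chainWords k (suc b) j)
  disjoint (w∈ , w∈′) with _ , _ , refl ← ∈-map⁻ (q ∷_) w∈
    with _ , _ , refl , b< , _ ← chainWords-sound k (suc b) j (s≤s z≤n) w∈′ = <-irrefl b≡q*j b<

length-concatMap : ∀ {A B : Set} (g : A → List B) xs → length (concatMap g xs) ≡ sum (map (length ∘ g) xs)
length-concatMap g []       = refl
length-concatMap g (x ∷ xs) = trans (length-++ (g x)) (cong (length (g x) +_) (length-concatMap g xs))

unique∧set⇒length : ∀ {A : Set} {xs ys : List A} → Unique xs → Unique ys →
                    (∀ {x} → x ∈ xs ⇔ x ∈ ys) → length xs ≡ length ys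
unique∧set⇒length u v eq = ↭.↭-length (∼bag⇒↭ (unique∧set⇒bag u v eq))

factorizationsUpTo : ℕ → List (List ℕ)
factorizationsUpTo n = concatMap orderedFactorizations (applyUpTo suc n)

factorizationsUpTo-unique : ∀ n → Unique (factorizationsUpTo n)
factorizationsUpTo-unique n = Uniqueₚ.concat⁺
  (Allₚ.map⁺ (All.universal orderedFactorizations-unique (applyUpTo suc n)))
  (AllPairsₚ.map⁺ (AllPairsₚ.applyUpTo⁺₁ suc n λ i<j _ (p , q) →
    <⇒≢ (s≤s i<j) (trans (sym (product≡ p)) (product≡ q))))
  where
  product≡ : ∀ {m as} → as ∈ orderedFactorizations m → product as ≡ m
  product≡ = proj₂ ∘ proj₂ ∘ orderedFactorizations-sound

-- From `j = 1` the chain ends in the product of the word, so the upper bound reads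
-- `product as ≤ suc k`, and `2 ≤ a * 1` is the condition on the first factor.
∈-chainWords⇔ : ∀ k {as} → as ∈ chainWords k 2 1 ⇔ as ∈ factorizationsUpTo (suc k)
∈-chainWords⇔ k = mk⇔ to from
  where
  to : ∀ {as} → as ∈ chainWords k 2 1 → as ∈ factorizationsUpTo (suc k)
  to as∈ with a , bs , refl , 2≤ , 2≤bs , s≤s p≤ ← chainWords-sound k 2 1 (s≤s z≤n) as∈ =
    ∈-concatMap⁺ orderedFactorizations (lose
      -- `∈-applyUpTo⁺ suc` yields successors only; the product is positive, hence the successor of
      -- its predecessor.
      (subst (_∈ applyUpTo suc (suc k)) (suc-pred _ {{>-nonZero (product>0 2≤as)}})
        (∈-applyUpTo⁺ suc (subst (_≤ suc k) (sym (suc-pred _ {{>-nonZero (product>0 2≤as)}}))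
           (subst (_≤ suc k) (*-identityʳ _) p≤))))
      (orderedFactorizations-complete ((λ ()) , 2≤as , refl)))
    where
    2≤as : All (2 ≤_) (a ∷ bs)
    2≤as = subst (2 ≤_) (*-identityʳ a) 2≤ ∷ 2≤bs
  from : ∀ {as} → as ∈ factorizationsUpTo (suc k) → as ∈ chainWords k 2 1
  from {as} as∈ with m , m∈ , as∈m ← find (∈-concatMap⁻ orderedFactorizations {xs = applyUpTo suc (suc k)} as∈)
    with i , i< , refl ← ∈-applyUpTo⁻ suc m∈ | orderedFactorizations-sound {m} as∈m
  ... | nonempty , [] , _ = ⊥-elim (nonempty refl)
  ... | _ , 2≤a ∷ 2≤bs , product≡ = chainWords-complete k 2 1 (s≤s z≤n) (s≤s z≤n)
    (_ , _ , refl , subst (2 ≤_) (sym (*-identityʳ _)) 2≤a , 2≤bs ,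
     s≤s (subst (_≤ suc k) (sym (trans (*-identityʳ _) product≡)) i<))

length-chainWords≡ : ∀ k → length (chainWords k 2 1) ≡ sum (map f (applyUpTo suc (suc k)))
length-chainWords≡ k = trans
  (unique∧set⇒length (chainWords-unique k 2 1 (s≤s z≤n)) (factorizationsUpTo-unique (suc k)) (∈-chainWords⇔ k))
  (length-concatMap orderedFactorizations (applyUpTo suc (suc k)))

-- Cycles of a permutation

module _ {A : Set} {R : A → A → Set} where

  linked-++⁻ : ∀ xs {z zs} → Linked R (xs ++ z ∷ zs) → Linked R (xs ∷ʳ z) × Linked R (z ∷ zs)
  linked-++⁻ []           l       = [-] , l
  linked-++⁻ (x ∷ [])     (r ∷ l) = r ∷ [-] , l
  linked-++⁻ (x ∷ y ∷ xs) (r ∷ l) = map₁ (r ∷_) (linked-++⁻ (y ∷ xs) l)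

  linked-++⁺ : ∀ xs {z zs} → Linked R (xs ∷ʳ z) → Linked R (z ∷ zs) → Linked R (xs ++ z ∷ zs)
  linked-++⁺ []           _       l = l
  linked-++⁺ (x ∷ [])     (r ∷ _) l = r ∷ l
  linked-++⁺ (x ∷ y ∷ xs) (r ∷ k) l = r ∷ linked-++⁺ (y ∷ xs) k l

  linked-init : ∀ xs {z} → Linked R (xs ∷ʳ z) → Linked R xs
  linked-init []           _       = []
  linked-init (x ∷ [])     _       = [-]
  linked-init (x ∷ y ∷ xs) (r ∷ l) = r ∷ linked-init (y ∷ xs) l

lookup-injective : ∀ {A : Set} {xs : List A} → Unique xs → ∀ {i j} → lookup xs i ≡ lookup xs j → i ≡ j
lookup-injective (x∉ ∷ u) {zero}  {zero}  eq = refl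
lookup-injective (x∉ ∷ u) {zero}  {suc j} eq = ⊥-elim (All.lookup x∉ (∈-lookup j) eq)
lookup-injective (x∉ ∷ u) {suc i} {zero}  eq = ⊥-elim (All.lookup x∉ (∈-lookup i) (sym eq))
lookup-injective (x∉ ∷ u) {suc i} {suc j} eq = cong suc (lookup-injective u eq)

unique-length : ∀ {n} {xs : List (Fin n)} → Unique xs → length xs ≤ n
unique-length u = injective⇒≤ (lookup-injective u)

unique-rotate : ∀ {A : Set} (xs ys : List A) → Unique (xs ++ ys) → Unique (ys ++ xs)
unique-rotate xs ys = ↭ₛ.Unique-resp-↭ (setoid _) (↭⇒↭ₛ (↭.++-comm xs ys))

module _ {n} (σ : Permutation′ n) where

  Step : Fin n → Fin n → Set
  Step i j = σ ⟨$⟩ʳ i ≡ j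

  -- Cut the closed walk from `x` to `x` at `y` and glue the two pieces at `x` instead; this gives
  -- the closed walk from `y` to `y`.
  cycle-rotate : ∀ xs ys → IsCycle σ (xs ++ ys) → IsCycle σ (ys ++ xs)
  cycle-rotate []       ys       cyc = subst (IsCycle σ) (sym (++-identityʳ ys)) cyc
  cycle-rotate (x ∷ xs) []       cyc = subst (IsCycle σ) (++-identityʳ (x ∷ xs)) cyc
  cycle-rotate (x ∷ xs) (y ∷ ys) (u , l) =
    unique-rotate (x ∷ xs) (y ∷ ys) u ,
    subst (Linked Step) (sym (++-assoc (y ∷ ys) (x ∷ xs) [ y ]))
      (linked-++⁺ (y ∷ ys) (proj₂ l′) (proj₁ l′))
    where l′ = linked-++⁻ (x ∷ xs) (subst (Linked Step) (++-assoc (x ∷ xs) (y ∷ ys) [ x ]) l)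

  cycle-resp-≈ᶜ : ∀ {c d} → c ≈ᶜ d → IsCycle σ c → IsCycle σ d
  cycle-resp-≈ᶜ (xs , ys , refl , refl) = cycle-rotate xs ys

  -- `drop 1` records that a successor occurs past the start of the path, which lets `prolong`
  -- detect a repetition of its first element.
  successor-∈ : ∀ xs {w e} → Linked Step (xs ∷ʳ e) → w ∈ xs → σ ⟨$⟩ʳ w ∈ drop 1 (xs ∷ʳ e)
  successor-∈ (x ∷ [])     (r ∷ _) (here refl) = here r
  successor-∈ (x ∷ y ∷ xs) (r ∷ _) (here refl) = here r
  successor-∈ (x ∷ y ∷ xs) (_ ∷ l) (there w∈)  = drop⊆ (successor-∈ (y ∷ xs) l w∈)
    where
    drop⊆ : ∀ {v : Fin n} {zs} → v ∈ drop 1 zs → v ∈ zs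
    drop⊆ {zs = _ ∷ _} = there

  -- A path ending in x is prolonged backwards until the predecessor of its first
  -- element lies on it; the path repeats no element, so that predecessor can only be x.
  prolong : ∀ {x} k {z zs} → n < k + length (z ∷ zs) → Unique (z ∷ zs) →
            Linked Step (z ∷ zs ∷ʳ (σ ⟨$⟩ʳ x)) → x ∈ z ∷ zs → ∃ λ c → IsCycle σ c × x ∈ c
  -- `k` bounds the remaining prolongations; at 0 the path would have more than `n` distinct
  -- elements of `Fin n`.
  prolong zero    n< u l x∈ = ⊥-elim (<⇒≱ n< (unique-length u))
  prolong {x} (suc k) {z} {zs} n< u l x∈ with _∈?_ Finₚ._≟_ (σ ⟨$⟩ˡ z) (z ∷ zs)
  ... | no w∉ = prolong k (subst (n <_) (sym (+-suc k _)) n<)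
                  (Allₚ.¬Any⇒All¬ _ w∉ ∷ u) (inverseʳ σ ∷ l) (there x∈)
  ... | yes w∈ with ∈-++⁻ zs (subst (_∈ zs ∷ʳ (σ ⟨$⟩ʳ x)) (inverseʳ σ) (successor-∈ (z ∷ zs) l w∈))
  ...   | inj₁ z∈zs        = ⊥-elim (Uniqueₚ.Unique[x∷xs]⇒x∉xs u z∈zs)
  ...   | inj₂ (here z≡σx) = z ∷ zs , (u , subst (λ e → Linked Step (z ∷ zs ∷ʳ e)) (sym z≡σx) l) , x∈

  rotate-to : ∀ {x c} → IsCycle σ c → x ∈ c → ∃ λ xs → c ≈ᶜ x ∷ xs × IsCycle σ (x ∷ xs)
  rotate-to cyc x∈c with as , bs , refl ← ∈-∃++ x∈c =
    bs ++ as , (as , _ , refl , refl) , cycle-rotate as _ cyc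

  cycle-through : ∀ x → ∃ λ xs → IsCycle σ (x ∷ xs)
  cycle-through x with c , cyc , x∈c ← prolong n (m<m+n n z<s) ([] ∷ []) (refl ∷ [-]) (here refl)
    with xs , _ , cyc′ ← rotate-to {x} cyc x∈c = xs , cyc′

  -- Both lists follow `σ` from `x` and stop at the first return, since `x` does not occur in either
  -- tail.
  cycle-unique : ∀ {x xs ys} → IsCycle σ (x ∷ xs) → IsCycle σ (x ∷ ys) → xs ≡ ys
  cycle-unique {x} (u , k) (v , l) = go k l (Uniqueₚ.Unique[x∷xs]⇒x∉xs u) (Uniqueₚ.Unique[x∷xs]⇒x∉xs v)
    where
    go : ∀ {a xs ys} → Linked Step (a ∷ xs ∷ʳ x) → Linked Step (a ∷ ys ∷ʳ x) →
         x ∉ xs → x ∉ ys → xs ≡ ys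
    go {xs = []}     {[]}     _       _       _  _  = refl
    go {xs = []}     {y ∷ ys} (p ∷ _) (q ∷ _) _  x∉ = ⊥-elim (x∉ (here (trans (sym p) q)))
    go {xs = y ∷ xs} {[]}     (p ∷ _) (q ∷ _) x∉ _  = ⊥-elim (x∉ (here (trans (sym q) p)))
    go {xs = y ∷ xs} {z ∷ ys} (p ∷ k) (q ∷ l) x∉ x∉′ with refl ← trans (sym p) q =
      cong (y ∷_) (go k l (x∉ ∘ there) (x∉′ ∘ there))

≈ᶜ-∈ : ∀ {A : Set} {c d : List A} {x} → c ≈ᶜ d → x ∈ c → x ∈ d
≈ᶜ-∈ (xs , ys , refl , refl) = ↭.∈-resp-↭ (↭.++-comm xs ys)

-- Contributing permutations of the Redheffer matrix

infix 4 _⊳_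
_⊳_ : ∀ {n} → Fin n → Fin n → Set
i ⊳ j = letter i ∣ letter j

letter-injective : ∀ {n} {i j : Fin n} → letter i ≡ letter j → i ≡ j
letter-injective = toℕ-injective ∘ suc-injective

contributes⇔ : ∀ {n} (σ : Permutation′ n) →
  Contributes (redheffer n) σ ⇔ (∀ i → i ⊳ σ ⟨$⟩ʳ i ⊎ letter (σ ⟨$⟩ʳ i) ≡ 1)
contributes⇔ {n} σ = mk⇔ (λ h i → to i _ (h i)) (λ h i → from i _ (h i))
  where
  nonzero? : ∀ (i j : Fin n) → Dec (i ⊳ j ⊎ letter j ≡ 1)
  nonzero? i j = (letter i ∣? letter j) ⊎-dec (letter j ≟ 1)
  to : ∀ i j → redheffer n i j ≢ 0 → i ⊳ j ⊎ letter j ≡ 1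
  to i j h = decidable-stable (nonzero? i j) λ ¬p →
    h (cong (λ b → if b then 1 else 0) (dec-false (nonzero? i j) ¬p))
  from : ∀ i j → i ⊳ j ⊎ letter j ≡ 1 → redheffer n i j ≢ 0
  from i j p rewrite dec-true (nonzero? i j) p = λ ()

module _ {m} (σ : Permutation′ (suc m)) (con : ∀ i → i ⊳ σ ⟨$⟩ʳ i ⊎ letter (σ ⟨$⟩ʳ i) ≡ 1) where

  linked-⊳ : ∀ {xs} → Linked (Step σ) xs → zero ∉ xs → Linked _⊳_ xs
  linked-⊳ []                         _  = []
  linked-⊳ [-]                        _  = [-]
  linked-⊳ {i ∷ j ∷ _} (refl ∷ l) 0∉ with con i
  ... | inj₁ i⊳j = i⊳j ∷ linked-⊳ l (0∉ ∘ there)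
  ... | inj₂ j≡1 = ⊥-elim (0∉ (there (here (sym (letter-injective j≡1)))))

  -- Around such a cycle the letters would increase under divisibility.
  cycle-avoiding-1 : ∀ {x xs} → IsCycle σ (x ∷ xs) → zero ∉ x ∷ xs → xs ≡ []
  cycle-avoiding-1 {xs = []}         _       _  = refl
  cycle-avoiding-1 {x} {xs = y ∷ ys} (u , l) 0∉
    with Linkedₚ.Linked⇒AllPairs ∣-trans (linked-⊳ l 0∉′)
    where
    0∉′ : zero ∉ x ∷ y ∷ ys ∷ʳ x
    0∉′ 0∈ with ∈-++⁻ (x ∷ y ∷ ys) 0∈
    ... | inj₁ p           = 0∉ p
    ... | inj₂ (here refl) = 0∉ (here refl)
  -- By transitivity `y` divides the closing copy of `x`; antisymmetry then gives `x ≡ y`, against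
  -- distinctness.
  ... | (x⊳y ∷ _) ∷ (y⊳ ∷ _) =
    ⊥-elim (Uniqueₚ.Unique[x∷xs]⇒x∉xs u (here (letter-injective
      (∣-antisym x⊳y (All.lookup y⊳ (∈-++⁺ʳ ys (here refl)))))))

  -- The cycle through the letter 1 decides. If it is trivial, every other cycle avoids 1 and is
  -- trivial too; if it is long, any long cycle must meet 1 and is a rotation of it.
  classify : σ ≈ id ⊎ HasSingleDivisionCycle σ
  classify with cycle-through σ zero
  ... | [] , cyc₀@(_ , fix ∷ _) = inj₁ fixed
    where
    fixed : σ ≈ id
    fixed zero = fix
    fixed i@(suc _) with cycle-through σ i
    ... | ys , cyc with _∈?_ Finₚ._≟_ zero (i ∷ ys)
    ...   | no 0∉ with refl ← cycle-avoiding-1 cyc 0∉ | _ , σi≡i ∷ _ ← cyc = σi≡i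
    -- Such a cycle would be a rotation of `zero ∷ []`, which does not contain `i`.
    ...   | yes 0∈ with zs , i∷ys≈ , cyc₁ ← rotate-to σ cyc 0∈
        with refl ← cycle-unique σ cyc₁ cyc₀ | here () ← ≈ᶜ-∈ i∷ys≈ (here refl)
  ... | xs@(_ ∷ _) , cyc@(u , _ ∷ l) =
    inj₂ (zero ∷ xs , (cyc , s≤s (s≤s z≤n)) , unique , here refl ,
          zero , xs , refl , ([] , _ , refl , sym (++-identityʳ _)) ,
          Linkedₚ.map⁺ (linked-⊳ (linked-init xs l) (Uniqueₚ.Unique[x∷xs]⇒x∉xs u)))
    where
    unique : ∀ d → IsLongCycle σ d → d ≈ᶜ zero ∷ xs
    unique d@(x ∷ ys) (cyc′ , long) with _∈?_ Finₚ._≟_ zero d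
    ... | yes 0∈ with _ , d≈ , cyc″ ← rotate-to σ cyc′ 0∈ =
      subst (λ zs → d ≈ᶜ zero ∷ zs) (cycle-unique σ cyc″ cyc) d≈
    ... | no 0∉ with refl ← cycle-avoiding-1 cyc′ 0∉ | s≤s () ← long

division-step : ∀ {n} (σ : Permutation′ n) {one i} → letter one ≡ 1 → ∀ xs →
  Linked (Step σ) (xs ∷ʳ one) → Linked _⊳_ xs → i ∈ xs → i ⊳ σ ⟨$⟩ʳ i ⊎ letter (σ ⟨$⟩ʳ i) ≡ 1
division-step σ one≡1 (x ∷ [])     (refl ∷ _) _         (here refl) = inj₂ one≡1
division-step σ one≡1 (x ∷ y ∷ xs) (refl ∷ _) (x⊳y ∷ _) (here refl) = inj₁ x⊳y
division-step σ one≡1 (x ∷ y ∷ xs) (_ ∷ k)    (_ ∷ l)   (there i∈)  = division-step σ one≡1 (y ∷ xs) k l i∈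

-- A fixed letter divides itself. Any other letter has a long cycle, which by uniqueness is a
-- rotation of `one ∷ js`; there each letter divides the next, and the last returns to 1.
single⇒contributes : ∀ {n} (σ : Permutation′ n) → HasSingleDivisionCycle σ →
  ∀ i → i ⊳ σ ⟨$⟩ʳ i ⊎ letter (σ ⟨$⟩ʳ i) ≡ 1
single⇒contributes σ (c , (cyc , _) , unique , _ , one , js , one≡1 , c≈ , chain) i
  with cycle-through σ i
... | [] , _ , σi≡i ∷ _ = inj₁ (∣-reflexive (cong letter (sym σi≡i)))
... | ys@(_ ∷ _) , cycᵢ =
  division-step σ one≡1 (one ∷ js) (proj₂ (cycle-resp-≈ᶜ σ c≈ cyc)) (from-one js (Linkedₚ.map⁻ chain))
    (≈ᶜ-∈ c≈ (≈ᶜ-∈ (unique (i ∷ ys) (cycᵢ , s≤s (s≤s z≤n))) (here refl)))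
  where
  from-one : ∀ js → Linked _⊳_ js → Linked _⊳_ (one ∷ js)
  from-one []      _ = [-]
  from-one (j ∷ _) l = subst (_∣ letter j) (sym one≡1) (1∣ letter j) ∷ l

contributes⇔cycle : ∀ n (σ : Permutation′ n) →
  Contributes (redheffer n) σ ⇔ (σ ≈ id ⊎ HasSingleDivisionCycle σ)
contributes⇔cycle n σ = mk⇔ (to n σ ∘ Equivalence.to (contributes⇔ σ)) (Equivalence.from (contributes⇔ σ) ∘ from)
  where
  to : ∀ n (σ : Permutation′ n) → (∀ i → i ⊳ σ ⟨$⟩ʳ i ⊎ letter (σ ⟨$⟩ʳ i) ≡ 1) →
       σ ≈ id ⊎ HasSingleDivisionCycle σ
  -- For `n = 0` there is no letter 1 whose cycle could be followed; every permutation is vacuously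
  -- the identity.
  to zero    σ _ = inj₁ λ ()
  to (suc m) σ   = classify σ
  from : σ ≈ id ⊎ HasSingleDivisionCycle σ → ∀ i → i ⊳ σ ⟨$⟩ʳ i ⊎ letter (σ ⟨$⟩ʳ i) ≡ 1
  from (inj₁ σ≈id)   i = inj₁ (∣-reflexive (cong letter (sym (σ≈id i))))
  from (inj₂ single)   = single⇒contributes σ single

theorem1 : (n : ℕ) →
    (permanent (redheffer n) ≡ 1 + sum (map f (applyUpTo suc n)))
    × ((σ : Permutation′ n) →
    Contributes (redheffer n) σ
    ⇔ (σ ≈ id ⊎ HasSingleDivisionCycle σ))
theorem1 zero    = refl , contributes⇔cycle zero
theorem1 (suc k) =
  trans (permanent-redheffer k) (cong suc (length-chainWords≡ k)) , contributes⇔cycle (suc k)
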